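{- Let $L$ be a continuous lattice with a fixed basis $B_L$ such that $\bot\notin B_L$, let $E$ be a system of $m$ equations over $L$ of the form $\boldsymbol{x} =_{\boldsymbol{\eta}} \boldsymbol{f}(\boldsymbol{x})$, and let $\boldsymbol{\sigma}=(\sigma_1,\dots,\sigma_m)$ be a selection for $E$. Moreover, for all $\boldsymbol{l}\in L^m$ let $\mathbf{A}_r(\boldsymbol{l})\subseteq B_L\times\underline{m}$ be such that $\mathbf{A}(\boldsymbol{l})=\{(b',i)\mid b'\in B_L,\ (b,i)\in\mathbf{A}_r(\boldsymbol{l})\text{ and } b'\sqsubseteq b \text{ for some } b\}$. Then the system of equations over the lattice $[\lambda_L]^m_\star$ defined, for $b\in B_L$ and $i\in\underline{m}$, by $$R(b)(i)=\min\nolimits_{\preceq_i}\{\sup\{R(b')(j)+\boldsymbol{\delta}^{\eta_i}_i\mid(b',j)\in\mathbf{A}_r(\boldsymbol{l})\}\mid\boldsymbol{l}\in\sigma_i(b)\}$$ has the same least solution as the progress measure equations for $E$, i.e. as the system $$R(b)(i)=\min\nolimits_{\preceq_i}\{\sup\{R(b')(j)+\boldsymbol{\delta}^{\eta_i}_i\mid(b',j)\in\mathbf{A}(\boldsymbol{l})\}\mid\boldsymbol{l}\in\mathbf{E}(b,i)\}.$$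
   Context: "Lattice" means complete lattice $(L,\sqsubseteq)$, with bottom $\bot$. $\underline{m}=\{1,\dots,m\}$, and $L^m$ carries the pointwise order. A basis of $L$ is $B_L\subseteq L$ with $l=\bigsqcup\{b\in B_L\mid b\sqsubseteq l\}$ for every $l\in L$. $l\ll l'$ iff for every directed $D\subseteq L$ with $l'\sqsubseteq\bigsqcup D$ there is $d\in D$ with $l\sqsubseteq d$. $L$ is continuous if $l=\bigsqcup\{l'\mid l'\ll l\}$ for all $l$. The height $\lambda_L$ is the supremum of the lengths of strictly ascending, possibly transfinite, chains in $L$. A system $E$ of $m$ equations, written $\boldsymbol{x}=_{\boldsymbol{\eta}}\boldsymbol{f}(\boldsymbol{x})$, is an ordered list $x_i=_{\eta_i} f_i(x_1,\dots,x_m)$, $i\in\underline{m}$, with $f_i\colon L^m\to L$ monotone and $\eta_i\in\{\mu,\nu\}$. Let $\mathbf{E}(b,i)=\{\boldsymbol{l}\in L^m\mid b\sqsubseteq f_i(\boldsymbol{l})\}$ for $b\in B_L$, $i\in\underline m$, and $\mathbf{A}(\boldsymbol{l})=\{(b,i)\mid i\in\underline{m},\ b\in B_L,\ b\ll l_i\}$ for $\boldsymbol l\in L^m$. A selection for $E$ is an $m$-tuple of functions $\sigma_i\colon B_L\to\mathbf{2}^{L^m}$ such that for every $b\in B_L$ and $i\in\underline{m}$, $\mathbf{E}(b,i)$ is the upward-closure of $\sigma_i(b)$ in $L^m$. Ordinal vectors: $[\lambda]^m_\star=\{\beta\mid\beta\le\lambda\}^m\cup\{\star\}$ for an ordinal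 $\lambda$. $\preceq$ is the lexicographic order with the last component most relevant, with $\star$ as added top. $\preceq_i$ compares lexicographically only the components $i,\dots,m$ (with $\star$ strictly above all tuples). For a set $X$ containing tuples, $\min_{\preceq_i}X=(0,\dots,0,x_i,\dots,x_m)$ where $(x_i,\dots,x_m)$ is the lexicographic minimum of the restrictions to components $i,\dots,m$ of the tuples in $X$; $\min_{\preceq_i}\emptyset=\min_{\preceq_i}\{\star\}=\star$. $\boldsymbol{\delta}^{\nu}_i$ is the null $m$-vector and $\boldsymbol{\delta}^{\mu}_i$ the $m$-vector with $1$ in position $i$ and $0$ elsewhere. Addition is componentwise, $\star+\boldsymbol{\delta}=\star$; the supremum is the least element of $[\lambda_L]^m_\star$ that is $\succeq$ all the listed vectors, where a listed vector whose $i$-th component is $\lambda_L+1$ is compared lexicographically as a vector of ordinals; $\sup\emptyset=(0,\dots,0)$. Least solutions are taken among functions $R\colon B_L\to\underline{m}\to[\lambda_L]^m_\star$ with respect to the pointwise order induced by $\preceq$. -}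

module Defs where

open import Level using (Level; _⊔_; suc; Lift; lower)
open import Data.Bool using (if_then_else_)
open import Data.Empty.Polymorphic using (⊥)
open import Data.Fin using (Fin; toℕ; _≟_)
open import Data.Nat as ℕ using (ℕ)
open import Data.Maybe using (map)
open import Data.Product using (Σ; ∃; ∃₂; _×_; _,_; proj₁; proj₂)
open import Data.Sum using (_⊎_; [_,_]′)
open import Data.Unit.Polymorphic using (⊤)
open import Data.Vec.Functional using (Vector; zipWith)
open import Data.Vec.Functional.Relation.Binary.Pointwise using (Pointwise)
open import Function using (_∘_; _on_)
open import Function.Definitions using (Congruent)
open import Relation.Binary using (Rel; Poset)
open import Relation.Binary.PropositionalEquality using (_≡_)
open import Relation.Nullary using (¬_; does)
open import Relation.Nullary.Construct.Add.Supremum using (_⁺; ⊤⁺; [_])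
open import Relation.Unary using (Pred; _∈_; _≐_)

import Relation.Binary.Construct.Add.Supremum.Equality as AddTopEquality
import Relation.Binary.Construct.Add.Supremum.NonStrict as AddTopOrder

------------------------------------------------------------------------
-- Ordinals

-- The tree  sup⁺ α  denotes the least ordinal strictly above every  α i,
-- so that classically  Ord a  presents the ordinals generated from index
-- sets in  Set a.  Different trees may denote the same ordinal: the
-- equality of ordinals is  _≈ᴼ_.

data Ord a : Set (suc a) where
  sup⁺ : {I : Set a} → (I → Ord a) → Ord a

infix 4 _≤ᴼ_ _<ᴼ_ _≈ᴼ_
infixl 6 _+ᴼ_

_≤ᴼ_ : ∀ {a b} → Ord a → Ord b → Set (a ⊔ b)
sup⁺ α ≤ᴼ sup⁺ β = ∀ i → ∃ λ j → α i ≤ᴼ β j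

_<ᴼ_ : ∀ {a b} → Ord a → Ord b → Set (a ⊔ b)
α <ᴼ sup⁺ β = ∃ λ j → α ≤ᴼ β j

_≈ᴼ_ : ∀ {a b} → Ord a → Ord b → Set (a ⊔ b)
α ≈ᴼ β = α ≤ᴼ β × β ≤ᴼ α

Branch : ∀ {a} → Ord a → Set a
Branch (sup⁺ {I} _) = I

branch : ∀ {a} (α : Ord a) → Branch α → Ord a
branch (sup⁺ α) = α

0ᴼ : ∀ {a} → Ord a
0ᴼ {a} = sup⁺ {I = ⊥} λ ()

1ᴼ : ∀ {a} → Ord a
1ᴼ = sup⁺ {I = ⊤} λ _ → 0ᴼ

-- α + β  is the least ordinal above all ordinals below  α  and all
-- α + γ  with  γ < β.

_+ᴼ_ : ∀ {a} → Ord a → Ord a → Ord a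
α +ᴼ sup⁺ β = sup⁺ [ branch α , (λ j → α +ᴼ β j) ]′

raise : ∀ a {b} → Ord b → Ord (a ⊔ b)
raise a (sup⁺ {I} α) = sup⁺ {I = Lift a I} λ i → raise a (α (lower i))

⋁ᴼ : ∀ {a b} {I : Set a} → (I → Ord b) → Ord (a ⊔ b)
⋁ᴼ {a} {I = I} α =
  sup⁺ {I = Σ I (Branch ∘ α)} λ (i , j) → raise a (branch (α i) j)

------------------------------------------------------------------------
-- Complete lattices

IsSup : ∀ {a r p} {A : Set a} → Rel A r → Pred A p → A → Set (a ⊔ r ⊔ p)
IsSup _≤_ P x =
  (∀ y → y ∈ P → y ≤ x) × (∀ z → (∀ y → y ∈ P → y ≤ z) → x ≤ z)

record CompleteLattice ℓ : Set (suc ℓ) where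
  field
    poset : Poset ℓ ℓ ℓ

  open Poset poset public renaming (_≤_ to _⊑_)

  field
    ⨆    : Pred Carrier ℓ → Carrier
    isSup : ∀ P → IsSup _⊑_ P (⨆ P)

  infix 4 _⊏_ _≪_

  bot : Carrier
  bot = ⨆ λ _ → ⊥

  _⊏_ : Rel Carrier ℓ
  x ⊏ y = x ⊑ y × ¬ x ≈ y

  Directed : Pred Carrier ℓ → Set ℓ
  Directed D =
    ∃ (_∈ D) ×
    (∀ x y → x ∈ D → y ∈ D → ∃ λ z → z ∈ D × x ⊑ z × y ⊑ z)

  _≪_ : Rel Carrier (suc ℓ)
  x ≪ y = ∀ D → Directed D → y ⊑ ⨆ D → ∃ λ d → d ∈ D × x ⊑ d

  Continuous : Set (suc ℓ)
  Continuous = ∀ x → IsSup _⊑_ (_≪ x) x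

  IsBasis : ∀ {p} → Pred Carrier p → Set (ℓ ⊔ p)
  IsBasis B = ∀ x → IsSup _⊑_ (λ b → b ∈ B × b ⊑ x) x

  -- A chain of length α is a sequence (x_β)_{β < α}.  Weak monotonicity
  -- makes x_β independent of the tree presenting β.

  record Chain (α : Ord ℓ) : Set (suc ℓ) where
    field
      at       : (β : Ord ℓ) → β <ᴼ α → Carrier
      monotone : ∀ {β γ} (p : β <ᴼ α) (q : γ <ᴼ α) → β ≤ᴼ γ → at β p ⊑ at γ q
      strict   : ∀ {β γ} (p : β <ᴼ α) (q : γ <ᴼ α) → β <ᴼ γ → at β p ⊏ at γ q

  height : Ord (suc ℓ)
  height = ⋁ᴼ {I = ∃ Chain} proj₁

------------------------------------------------------------------------
-- Vectors of ordinals

data Fix : Set where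
  μ ν : Fix

module _ {a : Level} {m : ℕ} where

  infix 4 _⪯_ _≋_
  infixl 6 _⊹_

  -- Lexicographic comparison of the components with index at least n,
  -- the last one being the most relevant.

  Lex : ℕ → Rel (Vector (Ord a) m) a
  Lex n x y =
    (∀ k → n ℕ.≤ toℕ k → x k ≈ᴼ y k) ⊎
    (∃ λ k → n ℕ.≤ toℕ k × x k <ᴼ y k ×
       (∀ j → toℕ k ℕ.< toℕ j → x j ≈ᴼ y j))

  _⪯_ : Rel (Vector (Ord a) m ⁺) (suc a)
  _⪯_ = AddTopOrder._≤⁺_ (Lex 0)

  _≋_ : Rel (Vector (Ord a) m ⁺) (suc a)
  _≋_ = AddTopEquality._≈⁺_ (Pointwise _≈ᴼ_)

  δ : Fix → Fin m → Vector (Ord a) m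
  δ ν i k = 0ᴼ
  δ μ i k = if does (k ≟ i) then 1ᴼ else 0ᴼ

  _⊹_ : Vector (Ord a) m ⁺ → Vector (Ord a) m → Vector (Ord a) m ⁺
  ⊤⁺    ⊹ y = ⊤⁺
  [ x ] ⊹ y = [ zipWith _+ᴼ_ x y ]

-- [ κ ]⋆ m  is  {β ∣ β ≤ κ}^m ∪ {⋆}, with ⊤⁺ as ⋆.

[_]⋆ : ∀ {a} → Ord a → ℕ → Set (suc a)
[ κ ]⋆ m = Vector (∃ λ β → β ≤ᴼ κ) m ⁺

module _ {a : Level} {κ : Ord a} {m : ℕ} where

  ords : Vector (∃ λ β → β ≤ᴼ κ) m → Vector (Ord a) m
  ords x k = proj₁ (x k)

  ⌊_⌋ : [ κ ]⋆ m → Vector (Ord a) m ⁺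
  ⌊_⌋ = map ords

  -- The listed vectors may exceed κ; their supremum is taken in [ κ ]⋆ m.

  IsSup⋆ : ∀ {p} → Pred (Vector (Ord a) m ⁺) p → [ κ ]⋆ m → Set (suc a ⊔ p)
  IsSup⋆ V x =
    (∀ v → v ∈ V → v ⪯ ⌊ x ⌋) ×
    (∀ y → (∀ v → v ∈ V → v ⪯ ⌊ y ⌋) → ⌊ x ⌋ ⪯ ⌊ y ⌋)

  data IsMin {p} (i : Fin m) (X : Pred ([ κ ]⋆ m) p) : [ κ ]⋆ m → Set (suc a ⊔ p) where
    no-tuple : (∀ x → ¬ [ x ] ∈ X) → IsMin i X ⊤⁺
    least    : ∀ {x z} → [ x ] ∈ X →
               (∀ y → [ y ] ∈ X → Lex (toℕ i) (ords x) (ords y)) →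
               (∀ k → toℕ i ℕ.≤ toℕ k → ords z k ≈ᴼ ords x k) →
               (∀ k → toℕ k ℕ.< toℕ i → ords z k ≈ᴼ 0ᴼ {a}) →
               IsMin i X [ z ]

------------------------------------------------------------------------
-- Systems of fixpoint equations

module _ {ℓ : Level} (L : CompleteLattice ℓ) where

  open CompleteLattice L

  record System (m : ℕ) : Set ℓ where
    field
      η        : Fin m → Fix
      f        : Fin m → Vector Carrier m → Carrier
      monotone : ∀ i {x y} → Pointwise _⊑_ x y → f i x ⊑ f i y

  module _ {p : Level} (B : Pred Carrier p) {m : ℕ} where

    private
      Lᵐ = Vector Carrier m

    𝐄 : System m → ∃ B → Fin m → Pred Lᵐ ℓ
    𝐄 E (b , _) i l = b ⊑ System.f E i l

    𝐀 : Lᵐ → Pred (∃ B × Fin m) (suc ℓ)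
    𝐀 l ((b , _) , i) = b ≪ l i

    UpClosure : ∀ {s} → Pred Lᵐ s → Pred Lᵐ (ℓ ⊔ s)
    UpClosure S l = ∃ λ l′ → l′ ∈ S × Pointwise _⊑_ l′ l

    IsSelection : ∀ {s} → System m → (Fin m → ∃ B → Pred Lᵐ s) → Set (ℓ ⊔ p ⊔ s)
    IsSelection E σ = ∀ b i → 𝐄 E b i ≐ UpClosure (σ i b)

    DownClosure : ∀ {r} → Pred (∃ B × Fin m) r → Pred (∃ B × Fin m) (ℓ ⊔ p ⊔ r)
    DownClosure A (b′ , i) = ∃ λ b → (b , i) ∈ A × proj₁ b′ ⊑ proj₁ b

    Measure : Set (p ⊔ suc (suc ℓ))
    Measure = ∃ B → Fin m → [ height ]⋆ m

    -- The system of equations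
    --   R(b)(i) = min_i { sup { R(b′)(j) + δ | (b′,j) ∈ N l } | l ∈ M b i }.

    Solves : ∀ {s r} → System m →
             (M : ∃ B → Fin m → Pred Lᵐ s) →
             (N : Lᵐ → Pred (∃ B × Fin m) r) →
             Measure → Set (p ⊔ s ⊔ r ⊔ suc (suc ℓ))
    Solves E M N R = ∀ b i →
      IsMin i
        (λ x → ∃ λ l → l ∈ M b i ×
           IsSup⋆ (λ v → ∃₂ λ b′ j → (b′ , j) ∈ N l ×
                     v ≡ ⌊ R b′ j ⌋ ⊹ δ (System.η E i) i) x)
        (R b i)

    -- A function on B must not depend on membership proofs, nor on the
    -- representative of an element of L.

    Extensional : Pred Measure (p ⊔ suc (suc ℓ))
    Extensional =
      Congruent (_≈_ on proj₁) (λ x y → ∀ i → ⌊ x i ⌋ ≋ ⌊ y i ⌋)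

    IsLeast : ∀ {q} → Pred Measure q → Measure → Set (p ⊔ q ⊔ suc (suc ℓ))
    IsLeast S R =
      Extensional R × R ∈ S ×
      (∀ R′ → Extensional R′ → R′ ∈ S → ∀ b i → ⌊ R b i ⌋ ⪯ ⌊ R′ b i ⌋)

{-# OPTIONS --safe #-}

-- Let Φ and Φᵣ be the right-hand sides of the progress measure equations and of
-- the equations for the selection.  Always Φᵣ R ≼ Φ R, and for R monotone in
-- the basis element also Φ R ≼ Φᵣ R: passing from A(l) to generators, or from
-- E(b,i) to the generators σᵢ(b), then changes neither the suprema nor the
-- minima.  Every value of Φ is monotone in b, hence so is its least fixpoint,
-- which therefore also solves the selection equations.  A solution R′ of the
-- latter need not be monotone, but its monotone hull M(b) = min { R′(c) | b ⊑ c }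
-- satisfies, for b ⊑ c,
--   Φ M (b) ⪯ Φ M (c) ⪯ Φᵣ R′ (c) = R′ (c),
-- so that M is a prefixpoint of Φ and the least fixpoint lies below M ≼ R′.
module Submission where

open import Level using (Level)
open import Axiom.ExcludedMiddle using (ExcludedMiddle)
open import Data.Fin using (Fin)
open import Data.Nat using (ℕ)
open import Data.Product using (∃; _×_)
open import Data.Vec.Functional using (Vector)
open import Relation.Nullary using (¬_)
open import Relation.Unary using (Pred; _∈_; _≐_)
open import Defs

open import Data.Fin as Fin using (toℕ; inject₁)
open import Data.Fin.Induction using (>-weakInduction)
open import Data.Fin.Properties
  using (<-cmp; toℕ<n; toℕ-fromℕ; toℕ-inject₁; toℕ-injective)
open import Data.Nat as ℕ using (z≤n)
open import Data.Nat.Properties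
  using (≤⇒≯; <⇒≤; m≤n⇒m<n∨m≡n; ≰⇒>; <-≤-trans)
  renaming (≤-trans to ≤ℕ-trans; ≤-refl to ≤ℕ-refl)
open import Data.Product using (Σ; ∃₂; _,_; proj₁; proj₂; swap)
open import Data.Sum using (_⊎_; inj₁; inj₂)
open import Data.Vec.Functional.Relation.Binary.Pointwise using (Pointwise)
open import Relation.Binary using (tri<; tri≈; tri>)
open import Relation.Binary.PropositionalEquality using (_≡_; refl; sym; subst)
open import Relation.Nullary using (Dec; yes; no; contradiction)
open import Relation.Nullary.Construct.Add.Supremum using (_⁺; ⊤⁺; [_])
open import Relation.Binary.Construct.Add.Supremum.NonStrict
  using (_≤⊤⁺; ≤⁺-trans; [_])
open import Relation.Binary.Construct.Add.Supremum.Equality using (⊤⁺≈⊤⁺; [_])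

private
  variable
    a b p q : Level

-- Order and addition of ordinal trees

≤ᴼ-refl : (α : Ord a) → α ≤ᴼ α
≤ᴼ-refl (sup⁺ α) i = i , ≤ᴼ-refl (α i)

≤ᴼ-trans : (α β γ : Ord a) → α ≤ᴼ β → β ≤ᴼ γ → α ≤ᴼ γ
≤ᴼ-trans (sup⁺ α) (sup⁺ β) (sup⁺ γ) α≤β β≤γ i =
  let j , αi≤βj = α≤β i
      k , βj≤γk = β≤γ j
  in  k , ≤ᴼ-trans (α i) (β j) (γ k) αi≤βj βj≤γk

≤-<-transᴼ : (α β γ : Ord a) → α ≤ᴼ β → β <ᴼ γ → α <ᴼ γ
≤-<-transᴼ α β (sup⁺ γ) α≤β (j , β≤γj) = j , ≤ᴼ-trans α β (γ j) α≤β β≤γj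

<-≤-transᴼ : (α β γ : Ord a) → α <ᴼ β → β ≤ᴼ γ → α <ᴼ γ
<-≤-transᴼ α (sup⁺ β) (sup⁺ γ) (j , α≤βj) β≤γ =
  let k , βj≤γk = β≤γ j in k , ≤ᴼ-trans α (β j) (γ k) α≤βj βj≤γk

<ᴼ⇒≤ᴼ : (α β : Ord a) → α <ᴼ β → α ≤ᴼ β
-- By induction each branch of `α i` lies below `α i`, which is itself a branch of `sup⁺ α`.
branch≤ᴼ : {I : Set a} (α : I → Ord a) → ∀ i → α i ≤ᴼ sup⁺ α

<ᴼ⇒≤ᴼ α (sup⁺ β) (j , α≤βj) = ≤ᴼ-trans α (β j) (sup⁺ β) α≤βj (branch≤ᴼ β j)

branch≤ᴼ α i with α i in eq
... | sup⁺ β = λ j → i , subst (β j ≤ᴼ_) (sym eq) (branch≤ᴼ β j)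

-- If `α` lay below its own branch `α i`, that branch would lie strictly below itself.
<ᴼ-irrefl : (α : Ord a) → ¬ α <ᴼ α
<ᴼ-irrefl (sup⁺ α) (i , α≤αi) =
  <ᴼ-irrefl (α i) (<-≤-transᴼ (α i) (sup⁺ α) (α i) (i , ≤ᴼ-refl (α i)) α≤αi)

≤ᴼ⇒≯ᴼ : (α β : Ord a) → α ≤ᴼ β → ¬ β <ᴼ α
≤ᴼ⇒≯ᴼ α β α≤β β<α = <ᴼ-irrefl α (≤-<-transᴼ α β α α≤β β<α)

<-transᴼ : (α β γ : Ord a) → α <ᴼ β → β <ᴼ γ → α <ᴼ γ
<-transᴼ α β γ α<β β<γ = ≤-<-transᴼ α β γ (<ᴼ⇒≤ᴼ α β α<β) β<γ

0ᴼ-minimum : (α : Ord a) → 0ᴼ {a} ≤ᴼ α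
0ᴼ-minimum (sup⁺ α) ()

≈ᴼ-refl : (α : Ord a) → α ≈ᴼ α
≈ᴼ-refl α = ≤ᴼ-refl α , ≤ᴼ-refl α

≈ᴼ-trans : (α β γ : Ord a) → α ≈ᴼ β → β ≈ᴼ γ → α ≈ᴼ γ
≈ᴼ-trans α β γ (α≤β , β≤α) (β≤γ , γ≤β) =
  ≤ᴼ-trans α β γ α≤β β≤γ , ≤ᴼ-trans γ β α γ≤β β≤α

+ᴼ-monoˡ-≤ : (α β γ : Ord a) → α ≤ᴼ β → α +ᴼ γ ≤ᴼ β +ᴼ γ
+ᴼ-monoˡ-≤ (sup⁺ α) (sup⁺ β) (sup⁺ γ) α≤β (inj₁ i) =
  let j , αi≤βj = α≤β i in inj₁ j , αi≤βj
+ᴼ-monoˡ-≤ α@(sup⁺ _) β@(sup⁺ _) (sup⁺ γ) α≤β (inj₂ k) =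
  inj₂ k , +ᴼ-monoˡ-≤ α β (γ k) α≤β

+0ᴼ-≤ : (α : Ord a) → α +ᴼ 0ᴼ ≤ᴼ α
+0ᴼ-≤ (sup⁺ α) (inj₁ i) = i , ≤ᴼ-refl (α i)

≤-+0ᴼ : (α : Ord a) → α ≤ᴼ α +ᴼ 0ᴼ
≤-+0ᴼ (sup⁺ α) i = inj₁ i , ≤ᴼ-refl (α i)

-- Adding on the right preserves `_<ᴼ_` only for special summands (0 + ω = 1 + ω), so the two values
-- of `δ`, 0 and 1, are treated separately.
+0ᴼ-mono-< : (α β : Ord a) → α <ᴼ β → α +ᴼ 0ᴼ <ᴼ β +ᴼ 0ᴼ
+0ᴼ-mono-< α β α<β =
  ≤-<-transᴼ (α +ᴼ 0ᴼ) α (β +ᴼ 0ᴼ) (+0ᴼ-≤ α)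
    (<-≤-transᴼ α β (β +ᴼ 0ᴼ) α<β (≤-+0ᴼ β))

+1ᴼ-mono-< : (α β : Ord a) → α <ᴼ β → α +ᴼ 1ᴼ <ᴼ β +ᴼ 1ᴼ
-- `inj₂ _` selects the branch `β +ᴼ 0ᴼ`; every branch of `α +ᴼ 1ᴼ` lies below `β′ j`, one of its
-- branches.
+1ᴼ-mono-< α@(sup⁺ α′) β@(sup⁺ β′) α<β@(j , α≤β′j) = inj₂ _ , λ where
  (inj₁ i) → inj₁ j , ≤ᴼ-trans (α′ i) α (β′ j) (branch≤ᴼ α′ i) α≤β′j
  (inj₂ _) → inj₁ j , ≤ᴼ-trans (α +ᴼ 0ᴼ) α (β′ j) (+0ᴼ-≤ α) α≤β′j

-- Lexicographic order with an added top

module _ {m : ℕ} where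

  Lex-trans : ∀ n (x y z : Vector (Ord a) m) → Lex n x y → Lex n y z → Lex n x z
  Lex-trans n x y z (inj₁ x≈y) (inj₁ y≈z) =
    inj₁ λ k n≤k → ≈ᴼ-trans (x k) (y k) (z k) (x≈y k n≤k) (y≈z k n≤k)
  Lex-trans n x y z (inj₁ x≈y) (inj₂ (k , n≤k , y<z , y≈z)) =
    inj₂ (k , n≤k , ≤-<-transᴼ (x k) (y k) (z k) (proj₁ (x≈y k n≤k)) y<z ,
      λ j k<j → ≈ᴼ-trans (x j) (y j) (z j) (x≈y j (≤ℕ-trans n≤k (<⇒≤ k<j))) (y≈z j k<j))
  Lex-trans n x y z (inj₂ (k , n≤k , x<y , x≈y)) (inj₁ y≈z) =
    inj₂ (k , n≤k , <-≤-transᴼ (x k) (y k) (z k) x<y (proj₁ (y≈z k n≤k)) ,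
      λ j k<j → ≈ᴼ-trans (x j) (y j) (z j) (x≈y j k<j) (y≈z j (≤ℕ-trans n≤k (<⇒≤ k<j))))
  Lex-trans n x y z (inj₂ (k , n≤k , x<y , x≈y)) (inj₂ (l , n≤l , y<z , y≈z))
    with <-cmp k l
  ... | tri< k<l _ _ =
    inj₂ (l , n≤l , ≤-<-transᴼ (x l) (y l) (z l) (proj₁ (x≈y l k<l)) y<z ,
      λ j l<j → ≈ᴼ-trans (x j) (y j) (z j) (x≈y j (≤ℕ-trans k<l (<⇒≤ l<j))) (y≈z j l<j))
  ... | tri≈ _ refl _ =
    inj₂ (k , n≤k , <-transᴼ (x k) (y k) (z k) x<y y<z ,
      λ j k<j → ≈ᴼ-trans (x j) (y j) (z j) (x≈y j k<j) (y≈z j k<j))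
  ... | tri> _ _ l<k =
    inj₂ (k , n≤k , <-≤-transᴼ (x k) (y k) (z k) x<y (proj₁ (y≈z k l<k)) ,
      λ j k<j → ≈ᴼ-trans (x j) (y j) (z j) (x≈y j k<j) (y≈z j (≤ℕ-trans l<k (<⇒≤ k<j))))

  Lex-antisym : (x y : Vector (Ord a) m) → Lex 0 x y → Lex 0 y x → Pointwise _≈ᴼ_ x y
  Lex-antisym x y (inj₁ x≈y) _ k = x≈y k z≤n
  Lex-antisym x y (inj₂ _) (inj₁ y≈x) k = swap (y≈x k z≤n)
  Lex-antisym x y (inj₂ (k , _ , x<y , x≈y)) (inj₂ (l , _ , y<x , y≈x)) _
    with <-cmp k l
  ... | tri< k<l _ _  = contradiction y<x (≤ᴼ⇒≯ᴼ (x l) (y l) (proj₁ (x≈y l k<l)))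
  ... | tri≈ _ refl _ = contradiction y<x (≤ᴼ⇒≯ᴼ (x k) (y k) (<ᴼ⇒≤ᴼ (x k) (y k) x<y))
  ... | tri> _ _ l<k  = contradiction x<y (≤ᴼ⇒≯ᴼ (y k) (x k) (proj₁ (y≈x k l<k)))

  -- If the deciding component has index below `n`, all components from `n` on agree.
  Lex-weaken : ∀ n (x y : Vector (Ord a) m) → Lex 0 x y → Lex n x y
  Lex-weaken n x y (inj₁ x≈y) = inj₁ λ k _ → x≈y k z≤n
  Lex-weaken n x y (inj₂ (k , _ , x<y , x≈y)) with n ℕ.≤? toℕ k
  ... | yes n≤k = inj₂ (k , n≤k , x<y , x≈y)
  ... | no  n≰k = inj₁ λ j n≤j → x≈y j (<-≤-trans (≰⇒> n≰k) n≤j)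

  Lex-extend : ∀ n (x y : Vector (Ord a) m) →
    (∀ k → toℕ k ℕ.< n → x k ≈ᴼ y k) → Lex n x y → Lex 0 x y
  Lex-extend n x y low (inj₂ (k , _ , x<y , x≈y)) = inj₂ (k , z≤n , x<y , x≈y)
  Lex-extend n x y low (inj₁ x≈y) = inj₁ λ k _ → eq k (n ℕ.≤? toℕ k)
    where
    eq : ∀ k → Dec (n ℕ.≤ toℕ k) → x k ≈ᴼ y k
    eq k (yes n≤k) = x≈y k n≤k
    eq k (no n≰k)  = low k (≰⇒> n≰k)

  ⪯-trans : {u v w : Vector (Ord a) m ⁺} → u ⪯ v → v ⪯ w → u ⪯ w
  ⪯-trans = ≤⁺-trans _ λ {x} {y} {z} → Lex-trans 0 x y z

  ⪯-refl : (u : Vector (Ord a) m ⁺) → u ⪯ u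
  ⪯-refl ⊤⁺    = ⊤⁺ ≤⊤⁺
  ⪯-refl [ x ] = [ inj₁ (λ k _ → ≈ᴼ-refl (x k)) ]

  ⪯-antisym : {u v : Vector (Ord a) m ⁺} → u ⪯ v → v ⪯ u → u ≋ v
  ⪯-antisym [ x≤y ] [ y≤x ] = [ Lex-antisym _ _ x≤y y≤x ]
  ⪯-antisym (⊤⁺ ≤⊤⁺) _ = ⊤⁺≈⊤⁺

  +δ-mono-≤ : ∀ η i k {α β : Ord a} → α ≤ᴼ β → α +ᴼ δ {m = m} η i k ≤ᴼ β +ᴼ δ {m = m} η i k
  +δ-mono-≤ η i k {α} {β} = +ᴼ-monoˡ-≤ α β (δ η i k)

  +δ-mono-< : ∀ η i k {α β : Ord a} → α <ᴼ β → α +ᴼ δ {m = m} η i k <ᴼ β +ᴼ δ {m = m} η i k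
  +δ-mono-< ν i k {α} {β} = +0ᴼ-mono-< α β
  +δ-mono-< μ i k {α} {β} with k Fin.≟ i
  ... | yes _ = +1ᴼ-mono-< α β
  ... | no  _ = +0ᴼ-mono-< α β

  -- Addition preserves equality above the deciding component and strictness at it.
  ⊹δ-mono : ∀ η i {u v : Vector (Ord a) m ⁺} → u ⪯ v → u ⊹ δ η i ⪯ v ⊹ δ η i
  ⊹δ-mono η i (_ ≤⊤⁺) = _ ≤⊤⁺
  ⊹δ-mono {a} η i ([_] {x} {y} x≤y) = [ go x≤y ]
    where
    eq : ∀ k → x k ≈ᴼ y k → x k +ᴼ δ η i k ≈ᴼ y k +ᴼ δ η i k
    eq k (x≤y , y≤x) = +δ-mono-≤ η i k x≤y , +δ-mono-≤ η i k y≤x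

    go : Lex 0 x y → Lex 0 (λ k → x k +ᴼ δ η i k) (λ k → y k +ᴼ δ η i k)
    go (inj₁ x≈y) = inj₁ λ k 0≤k → eq k (x≈y k 0≤k)
    go (inj₂ (k , 0≤k , x<y , x≈y)) =
      inj₂ (k , 0≤k , +δ-mono-< η i k x<y , λ j k<j → eq j (x≈y j k<j))

-- Comparing suprema and minima

module _ {κ : Ord a} {m : ℕ} where

  IsSup⋆-mono : {V : Pred (Vector (Ord a) m ⁺) p} {W : Pred (Vector (Ord a) m ⁺) q}
    (x y : [ κ ]⋆ m) → (∀ v → v ∈ V → ∃ λ w → w ∈ W × v ⪯ w) →
    IsSup⋆ V x → IsSup⋆ W y → ⌊ x ⌋ ⪯ ⌊ y ⌋
  IsSup⋆-mono x y V⪯W (_ , x-least) (y-upper , _) = x-least y λ v v∈V →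
    let w , w∈W , v⪯w = V⪯W v v∈V in ⪯-trans v⪯w (y-upper w w∈W)

  IsMin-mono : ∀ {i} {X : Pred ([ κ ]⋆ m) p} {Y : Pred ([ κ ]⋆ m) q} {x y : [ κ ]⋆ m} →
    (∀ v → v ∈ Y → ∃ λ u → u ∈ X × ⌊ u ⌋ ⪯ ⌊ v ⌋) →
    IsMin i X x → IsMin i Y y → ⌊ x ⌋ ⪯ ⌊ y ⌋
  IsMin-mono X⪯Y _ (no-tuple _) = _ ≤⊤⁺
  IsMin-mono {i = i} X⪯Y min (least {y₀} {y} y₀∈Y _ y≈y₀ y≈0)
    with X⪯Y [ y₀ ] y₀∈Y | min
  ... | [ u ] , u∈X , [ u≤y₀ ] | no-tuple none = contradiction u∈X (none u)
  ... | [ u ] , u∈X , [ u≤y₀ ] | least {x₀} {x} _ x₀≤ x≈x₀ x≈0 =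
    -- From `i` on, x ≈ x₀ ≤ u ≤ y₀ ≈ y; below `i` both minima vanish, so the comparison extends to
    -- all components.
    [ Lex-extend n _ _
        (λ k k<n → ≈ᴼ-trans (ords x k) 0ᴼ (ords y k) (x≈0 k k<n) (swap (y≈0 k k<n)))
        (Lex-trans n _ _ _ (inj₁ x≈x₀)
          (Lex-trans n _ _ _ (x₀≤ u u∈X)
            (Lex-trans n _ _ _ (Lex-weaken n _ _ u≤y₀)
              (inj₁ λ k n≤k → swap (y≈y₀ k n≤k))))) ]
    where
    n = toℕ i

  -- Antisymmetry gives equality only up to `_≋_`; this turns such an equality with a minimum into a
  -- solution of the equation.
  IsMin-resp-≋ : ∀ {i} {X : Pred ([ κ ]⋆ m) p} {x y : [ κ ]⋆ m} →
    ⌊ x ⌋ ≋ ⌊ y ⌋ → IsMin i X x → IsMin i X y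
  IsMin-resp-≋ {y = ⊤⁺} _ (no-tuple none) = no-tuple none
  IsMin-resp-≋ {y = [ y ]} [ z≈y ] (least {x} {z} x∈X x≤ z≈x z≈0) =
    least x∈X x≤
      (λ k n≤k → ≈ᴼ-trans (ords y k) (ords z k) (ords x k) (swap (z≈y k)) (z≈x k n≤k))
      (λ k k<n → ≈ᴼ-trans (ords y k) (ords z k) 0ᴼ (swap (z≈y k)) (z≈0 k k<n))

-- Classical existence of minima and suprema

module Classical (em : ∀ {a} → ExcludedMiddle a) where

  -- If a branch `α i` lies below no `β j`, then by induction every `β j` is strictly below it,
  -- which says `sup⁺ β ≤ᴼ α i`.
  ≰ᴼ⇒>ᴼ : (α β : Ord a) → ¬ α ≤ᴼ β → β <ᴼ α
  ≰ᴼ⇒>ᴼ (sup⁺ α) (sup⁺ β) α≰β with em {P = ∃ λ i → ∀ j → ¬ α i ≤ᴼ β j}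
  ... | yes (i , αi≰β) = i , below (α i) λ j → ≰ᴼ⇒>ᴼ (α i) (β j) (αi≰β j)
    where
    below : ∀ γ → (∀ j → β j <ᴼ γ) → sup⁺ β ≤ᴼ γ
    below (sup⁺ γ) β<γ = β<γ
  ... | no none = contradiction α≤β α≰β
    where
    α≤β : sup⁺ α ≤ᴼ sup⁺ β
    α≤β i with em {P = ∃ λ j → α i ≤ᴼ β j}
    ... | yes above = above
    ... | no ¬above = contradiction (i , λ j αi≤βj → ¬above (j , αi≤βj)) none

  argminᴼ : {A : Set p} (f : A → Ord a) → A → ∃ λ x → ∀ y → f x ≤ᴼ f y
  argminᴼ {A = A} f x₀ = go (f x₀) x₀ (≤ᴼ-refl (f x₀))
    where
    -- The recursion descends on the bound `α`: a smaller value `f y` lies below a branch of `α`,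
    -- but need not be a subtree of `f x`.
    go : ∀ α x → f x ≤ᴼ α → ∃ λ x → ∀ y → f x ≤ᴼ f y
    go (sup⁺ α) x fx≤α with em {P = ∃ λ y → f y <ᴼ f x}
    ... | yes (y , fy<fx) =
      let j , fy≤αj = <-≤-transᴼ (f y) (f x) (sup⁺ α) fy<fx fx≤α in go (α j) y fy≤αj
    ... | no none = x , λ y → ≤fy y
      where
      ≤fy : ∀ y → f x ≤ᴼ f y
      ≤fy y with em {P = f x ≤ᴼ f y}
      ... | yes fx≤fy = fx≤fy
      ... | no  fx≰fy = contradiction (y , ≰ᴼ⇒>ᴼ (f x) (f y) fx≰fy) none

  -- Descending through the components, minimise component k among those
  -- elements that agree in the components above k with a minimum for them.
  module _ {m : ℕ} {A : Set p} (f : A → Vector (Ord a) m) where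

    private
      refine : ∀ k → (∃ λ x → ∀ y → Lex (ℕ.suc (toℕ k)) (f x) (f y)) →
               ∃ λ x → ∀ y → Lex (toℕ k) (f x) (f y)
      refine k (x , x≤)
        with argminᴼ {A = Σ A λ y → ∀ j → toℕ k ℕ.< toℕ j → f x j ≈ᴼ f y j}
               (λ (y , _) → f y k) (x , λ j _ → ≈ᴼ-refl (f x j))
      ... | (z , x≈z) , z≤ = z , λ y → z≤y y (x≤ y)
        where
        z≤y : ∀ y → Lex (ℕ.suc (toℕ k)) (f x) (f y) → Lex (toℕ k) (f z) (f y)
        z≤y y (inj₂ (j , k<j , x<y , x≈y)) = inj₂ (j , <⇒≤ k<j ,
          ≤-<-transᴼ (f z j) (f x j) (f y j) (proj₂ (x≈z j k<j)) x<y ,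
          λ l j<l → ≈ᴼ-trans (f z l) (f x l) (f y l)
            (swap (x≈z l (≤ℕ-trans k<j (<⇒≤ j<l)))) (x≈y l j<l))
        z≤y y (inj₁ x≈y) with em {P = f y k ≤ᴼ f z k}
        ... | no y≰z = inj₂ (k , ≤ℕ-refl , ≰ᴼ⇒>ᴼ (f y k) (f z k) y≰z ,
          λ j k<j → ≈ᴼ-trans (f z j) (f x j) (f y j) (swap (x≈z j k<j)) (x≈y j k<j))
        ... | yes y≤z = inj₁ λ j k≤j → z≈y j (m≤n⇒m<n∨m≡n k≤j)
          where
          z≈y : ∀ j → toℕ k ℕ.< toℕ j ⊎ toℕ k ≡ toℕ j → f z j ≈ᴼ f y j
          z≈y j (inj₁ k<j) = ≈ᴼ-trans (f z j) (f x j) (f y j) (swap (x≈z j k<j)) (x≈y j k<j)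
          z≈y j (inj₂ k≡j) with refl ← toℕ-injective k≡j = z≤ (y , x≈y) , y≤z

    argmin-Lex : A → (i : Fin (ℕ.suc m)) → ∃ λ x → ∀ y → Lex (toℕ i) (f x) (f y)
    argmin-Lex x₀ = >-weakInduction _
      -- From index `m` on there are no components to compare, so any element is minimal.
      (x₀ , λ y → inj₁ λ k m≤k →
        contradiction (toℕ<n k) (≤⇒≯ (subst (ℕ._≤ toℕ k) (toℕ-fromℕ m) m≤k)))
      (λ k ih → subst (λ n → ∃ λ x → ∀ y → Lex n (f x) (f y))
        (sym (toℕ-inject₁ k)) (refine k ih))

  module _ {κ : Ord a} {m : ℕ} where

    -- Either some value is a tuple and minimising among tuples suffices, or all values are `⊤⁺`.
    argmin⋆ : {A : Set p} (f : A → [ κ ]⋆ m) → A → ∃ λ x → ∀ y → ⌊ f x ⌋ ⪯ ⌊ f y ⌋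
    argmin⋆ {A = A} f x₀ with em {P = ∃₂ λ x t → f x ≡ [ t ]}
    ... | yes (x₁ , tuple₁)
      with argmin-Lex {A = ∃₂ λ x t → f x ≡ [ t ]} (λ (_ , t , _) → ords t) (x₁ , tuple₁) Fin.zero
    ... | (x , t , fx≡t) , x≤ = x , fx⪯
      where
      fx⪯ : ∀ y → ⌊ f x ⌋ ⪯ ⌊ f y ⌋
      fx⪯ y with f y in fy≡
      ... | ⊤⁺    = _ ≤⊤⁺
      ... | [ u ] rewrite fx≡t = [ x≤ (y , u , fy≡) ]
    argmin⋆ f x₀ | no none = x₀ , x₀⪯
      where
      x₀⪯ : ∀ y → ⌊ f x₀ ⌋ ⪯ ⌊ f y ⌋
      x₀⪯ y with f y in fy≡
      ... | ⊤⁺    = _ ≤⊤⁺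
      ... | [ u ] = contradiction (y , u , fy≡) none

    -- The least of the upper bounds in `[ κ ]⋆ m`, of which `⊤⁺` is always one.
    sup⋆ : (V : Pred (Vector (Ord a) m ⁺) p) → ∃ λ (x : [ κ ]⋆ m) → IsSup⋆ V x
    sup⋆ V with argmin⋆ {A = ∃ λ (x : [ κ ]⋆ m) → ∀ v → v ∈ V → v ⪯ ⌊ x ⌋} proj₁
                  (⊤⁺ , λ _ _ → _ ≤⊤⁺)
    ... | (x , upper) , x≤ = x , upper , λ y y-upper → x≤ (y , y-upper)

    min⋆ : ∀ i (X : Pred ([ κ ]⋆ m) p) → ∃ λ x → IsMin i X x
    min⋆ i X with em {P = ∃ λ x → [ x ] ∈ X}
    ... | no none = ⊤⁺ , no-tuple λ x x∈X → none (x , x∈X)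
    ... | yes tuple with argmin-Lex {A = ∃ λ x → [ x ] ∈ X} (λ (x , _) → ords x) tuple (inject₁ i)
    ... | (x , x∈X) , x≤ =
      [ z ] , least x∈X
        (λ y y∈X → subst (λ n → Lex n (ords x) (ords y)) (toℕ-inject₁ i) (x≤ (y , y∈X)))
        high low
      where
      z : Vector (∃ λ β → β ≤ᴼ κ) m
      z k with toℕ i ℕ.≤? toℕ k
      ... | yes _ = x k
      ... | no  _ = 0ᴼ , 0ᴼ-minimum κ

      high : ∀ k → toℕ i ℕ.≤ toℕ k → ords z k ≈ᴼ ords x k
      high k i≤k with toℕ i ℕ.≤? toℕ k
      ... | yes _   = ≈ᴼ-refl (ords x k)
      ... | no  i≰k = contradiction i≤k i≰k

      low : ∀ k → toℕ k ℕ.< toℕ i → ords z k ≈ᴼ 0ᴼ {a}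
      low k k<i with toℕ i ℕ.≤? toℕ k
      ... | yes i≤k = contradiction k<i (≤⇒≯ i≤k)
      ... | no  _   = ≈ᴼ-refl 0ᴼ

  -- The progress measure operator and its least fixpoint

  module _ {ℓ : Level} (L : CompleteLattice ℓ) {p : Level}
           (B : Pred (CompleteLattice.Carrier L) p) {m : ℕ} (E : System L m) where

    open CompleteLattice L renaming (refl to ⊑-refl)
    open System E using (η)

    infix 4 _≼_

    _≼_ : Measure L B {m} → Measure L B {m} → Set _
    R ≼ R′ = ∀ b i → ⌊ R b i ⌋ ⪯ ⌊ R′ b i ⌋

    ≼-refl : ∀ R → R ≼ R
    ≼-refl R b i = ⪯-refl ⌊ R b i ⌋

    Monotone : Pred (Measure L B {m}) _
    Monotone R = ∀ b c i → proj₁ b ⊑ proj₁ c → ⌊ R b i ⌋ ⪯ ⌊ R c i ⌋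

    monotone⇒extensional : ∀ R → Monotone R → Extensional L B R
    monotone⇒extensional R mono b≈c i =
      ⪯-antisym (mono _ _ i (reflexive b≈c)) (mono _ _ i (reflexive (Eq.sym b≈c)))

    Values : ∀ {s r} → Pred (Vector Carrier m) s →
             (Vector Carrier m → Pred (∃ B × Fin m) r) →
             Measure L B {m} → Fin m → Pred ([ height ]⋆ m) _
    Values M N R i x = ∃ λ l → l ∈ M × IsSup⋆ (λ v → ∃₂ λ b j → (b , j) ∈ N l ×
      v ≡ ⌊ R b j ⌋ ⊹ δ (η i) i) x

    -- A minimum drops when it has more candidates and a supremum drops when its vectors do. All
    -- comparisons of right-hand sides below are instances, whence the independent `M`, `N` and `R`.
    IsMin-Values-mono : ∀ {s r s′ r′}
      {M : Pred (Vector Carrier m) s} {N : Vector Carrier m → Pred (∃ B × Fin m) r}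
      {M′ : Pred (Vector Carrier m) s′} {N′ : Vector Carrier m → Pred (∃ B × Fin m) r′}
      (R R′ : Measure L B {m}) {i : Fin m} {x y : [ height ]⋆ m} →
      (∀ l′ → l′ ∈ M′ → ∃ λ l → l ∈ M × (∀ b j → (b , j) ∈ N l →
        ∃ λ b′ → (b′ , j) ∈ N′ l′ × ⌊ R b j ⌋ ⪯ ⌊ R′ b′ j ⌋)) →
      IsMin i (Values M N R i) x → IsMin i (Values M′ N′ R′ i) y → ⌊ x ⌋ ⪯ ⌊ y ⌋
    IsMin-Values-mono R R′ {i} M⪯M′ = IsMin-mono λ v (l′ , l′∈M′ , v-sup) →
      let l , l∈M , N⪯N′ = M⪯M′ l′ l′∈M′
          u , u-sup      = sup⋆ _
      in  u , (l , l∈M , u-sup) , IsSup⋆-mono u v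
            (λ { _ (b , j , bj∈N , refl) →
                 let b′ , b′j∈N′ , R⪯R′ = N⪯N′ b j bj∈N
                 in  _ , (b′ , j , b′j∈N′ , refl) , ⊹δ-mono (η i) i R⪯R′ })
            u-sup v-sup

    Φ : Measure L B {m} → Measure L B {m}
    Φ R b i = proj₁ (min⋆ i (Values (𝐄 L B E b i) (𝐀 L B) R i))

    Φ-isMin : ∀ R b i → IsMin i (Values (𝐄 L B E b i) (𝐀 L B) R i) (Φ R b i)
    Φ-isMin R b i = proj₂ (min⋆ i (Values (𝐄 L B E b i) (𝐀 L B) R i))

    Φ-mono : ∀ R R′ → R ≼ R′ → Φ R ≼ Φ R′
    Φ-mono R R′ R≼R′ b i = IsMin-Values-mono R R′
      (λ l l∈E → l , l∈E , λ c j c∈A → c , c∈A , R≼R′ c j)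
      (Φ-isMin R b i) (Φ-isMin R′ b i)

    -- A larger basis element leaves fewer vectors in `𝐄`.
    Φ-image-monotone : ∀ R → Monotone (Φ R)
    Φ-image-monotone R b c i b⊑c = IsMin-Values-mono R R
      (λ l c⊑fl → l , trans b⊑c c⊑fl , λ d j d∈A → d , d∈A , ≼-refl R d j)
      (Φ-isMin R b i) (Φ-isMin R c i)

    Prefixed : Set _
    Prefixed = ∃ λ R → Φ R ≼ R

    -- The lexicographic order is total with minima of all nonempty families, so the
    -- pointwise infimum of the prefixpoints is attained at each argument.
    private
      leastAt : ∀ b i → ∃ λ (R : Prefixed) → ∀ (R′ : Prefixed) →
                ⌊ proj₁ R b i ⌋ ⪯ ⌊ proj₁ R′ b i ⌋
      -- The constant `⊤⁺` is a prefixpoint, so the family is nonempty.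
      leastAt b i = argmin⋆ (λ R → proj₁ R b i) ((λ _ _ → ⊤⁺) , λ _ _ → _ ≤⊤⁺)

    lfp : Measure L B {m}
    lfp b i = proj₁ (proj₁ (leastAt b i)) b i

    lfp-≼ : ∀ R → Φ R ≼ R → lfp ≼ R
    lfp-≼ R ΦR≼R b i = proj₂ (leastAt b i) (R , ΦR≼R)

    lfp-prefixed : Φ lfp ≼ lfp
    lfp-prefixed b i =
      -- This `R` depends on `b` and `i`: it equals `lfp` there and lies above it everywhere.
      let (R , ΦR≼R) , _ = leastAt b i
      in  ⪯-trans (Φ-mono lfp R (lfp-≼ R ΦR≼R) b i) (ΦR≼R b i)

    lfp-postfixed : lfp ≼ Φ lfp
    lfp-postfixed = lfp-≼ (Φ lfp) (Φ-mono (Φ lfp) lfp lfp-prefixed)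

    lfp-monotone : Monotone lfp
    lfp-monotone b c i b⊑c =
      ⪯-trans (lfp-postfixed b i)
        (⪯-trans (Φ-image-monotone lfp b c i b⊑c) (lfp-prefixed c i))

    lfp-isLeast : IsLeast L B (Solves L B E (𝐄 L B E) (𝐀 L B)) lfp
    lfp-isLeast =
      monotone⇒extensional lfp lfp-monotone ,
      (λ b i → IsMin-resp-≋ (⪯-antisym (lfp-prefixed b i) (lfp-postfixed b i))
                 (Φ-isMin lfp b i)) ,
      -- Minima of the same set are comparable, so a solution is a prefixpoint even where `Φ` chose
      -- other trees.
      λ R _ solves → lfp-≼ R λ b i → IsMin-Values-mono R R
        (λ l l∈E → l , l∈E , λ c j c∈A → c , c∈A , ≼-refl R c j)
        (Φ-isMin R b i) (solves b i)

    -- Monotone hull of a measure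

    private
      Above : ∃ B → Set _
      Above b = Σ (∃ B) λ c → proj₁ b ⊑ proj₁ c

      argminAbove : ∀ (R : Measure L B {m}) b i → ∃ λ (c : Above b) → ∀ (d : Above b) →
                    ⌊ R (proj₁ c) i ⌋ ⪯ ⌊ R (proj₁ d) i ⌋
      argminAbove R b i = argmin⋆ (λ (c : Above b) → R (proj₁ c) i) (b , ⊑-refl)

    hull : Measure L B {m} → Measure L B {m}
    hull R b i = R (proj₁ (proj₁ (argminAbove R b i))) i

    hull-lower : ∀ R b c i → proj₁ b ⊑ proj₁ c → ⌊ hull R b i ⌋ ⪯ ⌊ R c i ⌋
    hull-lower R b c i b⊑c = proj₂ (argminAbove R b i) (c , b⊑c)

    hull-greatest : ∀ R b i {u} → (∀ c → proj₁ b ⊑ proj₁ c → u ⪯ ⌊ R c i ⌋) →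
                    u ⪯ ⌊ hull R b i ⌋
    hull-greatest R b i u⪯ = let (c , b⊑c) , _ = argminAbove R b i in u⪯ c b⊑c

    hull-monotone : ∀ R → Monotone (hull R)
    hull-monotone R b c i b⊑c = hull-greatest R c i λ d c⊑d →
      hull-lower R b d i (trans b⊑c c⊑d)

    -- Comparison with the selection equations

    module _ {s r : Level}
      (σ : Fin m → ∃ B → Pred (Vector Carrier m) s) (isSelection : IsSelection L B E σ)
      (Aᵣ : Vector Carrier m → Pred (∃ B × Fin m) r)
      (generates : ∀ l → 𝐀 L B l ≐ DownClosure L B (Aᵣ l)) where

      -- Each `c` in `𝐀 l` lies below a generator `d`, and monotonicity of `R` passes from `c` to
      -- `d`. Separate `R` and `R′` allow both `lfp` with itself and a hull with its original.
      σ⇒Φ : ∀ R R′ → Monotone R → R ≼ R′ → ∀ b i {x} →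
            IsMin i (Values (σ i b) Aᵣ R′ i) x → ⌊ Φ R b i ⌋ ⪯ ⌊ x ⌋
      σ⇒Φ R R′ mono R≼R′ b i = IsMin-Values-mono R R′
        (λ l l∈σ → l , proj₂ (isSelection b i) {l} (l , l∈σ , λ _ → ⊑-refl) , λ c j c∈A →
          let d , d∈Aᵣ , c⊑d = proj₁ (generates l) {c , j} c∈A
          in  d , d∈Aᵣ , ⪯-trans (mono c d j c⊑d) (R≼R′ d j))
        (Φ-isMin R b i)

      Φ⇒σ : ∀ R b i {x} → IsMin i (Values (σ i b) Aᵣ R i) x → ⌊ x ⌋ ⪯ ⌊ Φ R b i ⌋
      Φ⇒σ R b i min = IsMin-Values-mono R R
        (λ l l∈E → let l′ , l′∈σ , l′⊑l = proj₁ (isSelection b i) l∈E in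
          l′ , l′∈σ , λ c j c∈Aᵣ → c ,
            -- A generator belongs to its own down-closure, so `c` is way below `l′ j`, hence way
            -- below the larger `l j`.
            (λ D directed l⊑⨆D →
              proj₂ (generates l′) {c , j} (c , c∈Aᵣ , ⊑-refl) D directed
                (trans (l′⊑l j) l⊑⨆D)) ,
            ≼-refl R c j)
        min (Φ-isMin R b i)

      lfp-solves-σ : Solves L B E (λ b i → σ i b) Aᵣ lfp
      lfp-solves-σ b i =
        let x , min = min⋆ i (Values (σ i b) Aᵣ lfp i)
        in  IsMin-resp-≋
              (⪯-antisym
                (⪯-trans (Φ⇒σ lfp b i min) (lfp-prefixed b i))
                (⪯-trans (lfp-postfixed b i) (σ⇒Φ lfp lfp lfp-monotone (≼-refl lfp) b i min)))
              min

      hull-prefixed : ∀ R → Solves L B E (λ b i → σ i b) Aᵣ R → Φ (hull R) ≼ hull R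
      hull-prefixed R solves b i = hull-greatest R b i λ c b⊑c →
        ⪯-trans (Φ-image-monotone (hull R) b c i b⊑c)
          (σ⇒Φ (hull R) R (hull-monotone R) (λ d j → hull-lower R d d j ⊑-refl) c i (solves c i))

      lfp-isLeast-σ : IsLeast L B (Solves L B E (λ b i → σ i b) Aᵣ) lfp
      lfp-isLeast-σ =
        monotone⇒extensional lfp lfp-monotone ,
        lfp-solves-σ ,
        λ R _ solves b i → ⪯-trans (lfp-≼ (hull R) (hull-prefixed R solves) b i)
          (hull-lower R b b i ⊑-refl)

lemma5p12 : (em : ∀ {a} → ExcludedMiddle a) →
    ∀ {ℓ p s r : Level} (L : CompleteLattice ℓ) → let open CompleteLattice L in
    Continuous →
    (B : Pred Carrier p) → IsBasis B → (∀ b → b ∈ B → ¬ (b ≈ bot)) →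
    (m : ℕ) (E : System L m) →
    (σ : Fin m → ∃ B → Pred (Vector Carrier m) s) → IsSelection L B E σ →
    (Aᵣ : Vector Carrier m → Pred (∃ B × Fin m) r) →
    (∀ l → 𝐀 L B l ≐ DownClosure L B (Aᵣ l)) →
    ∃ λ (R : Measure L B {m}) →
    IsLeast L B (Solves L B E (λ b i → σ i b) Aᵣ) R ×
    IsLeast L B (Solves L B E (𝐄 L B E) (𝐀 L B)) R
lemma5p12 em L _ B _ _ m E σ isSelection Aᵣ generates =
  lfp L B E , lfp-isLeast-σ L B E σ isSelection Aᵣ generates , lfp-isLeast L B E
  where
  open Classical em
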